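{- Let $Sp(K,S)$ and $Sp'(K',S')$ be (disjoint) split graphs with $|K|=|S|$ and $|K'|=|S'|$. Then $Sp\circ Sp'$ is nonsingular if and only if $Sp$ and $Sp'$ are both nonsingular.
   Context: Graphs are finite and simple. A split graph is a graph $Sp$ whose vertex set is a disjoint union of a clique $K$ and an independent set $S$; the pair $(K,S)$ is called an s-partition, and $Sp(K,S)$ denotes $Sp$ together with this s-partition. Both parts of an s-partition are assumed nonempty. A graph is nonsingular if its adjacency matrix is invertible. For a split graph $Sp(K,S)$ and a graph $G$ disjoint from it, the Tyshkevich composition $Sp\circ G$ is the graph with vertex set $V(Sp)\cup V(G)$ and edge set $E(Sp)\cup E(G)\cup\{xy: x\in K,\ y\in V(G)\}$. -}

module Defs where

open import Data.Bool.Base using (Bool; true; false; T; if_then_else_)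
open import Data.Fin.Base using (Fin; splitAt)
open import Data.Fin.Properties using (_≟_)
open import Data.Fin.Subset using (Subset; _∈_; Nonempty; _∩_; _∪_; ⊤; ⊥)
open import Data.Fin.Subset.Properties using (_∈?_)
open import Data.Nat.Base using (ℕ; _+_)
open import Data.Product.Base using (_×_; ∃-syntax)
open import Data.Rational.Base using (ℚ; 0ℚ; 1ℚ; _*_)
open import Data.Rational.Properties using (+-*-commutativeRing)
open import Data.Sum.Base using (_⊎_; inj₁; inj₂)
open import Relation.Binary.PropositionalEquality.Core using (_≡_; _≢_; refl)
open import Relation.Nullary.Decidable.Core using (does)
open import Relation.Nullary.Negation.Core using (¬_)

open import Algebra.Bundles using (CommutativeRing)
open import Algebra.Properties.Semiring.Sum
  (CommutativeRing.semiring +-*-commutativeRing) using (sum)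

record Graph (n : ℕ) : Set where
  field
    adj     : Fin n → Fin n → Bool
    adj-sym : ∀ i j → adj i j ≡ adj j i
    no-loop : ∀ i → adj i i ≡ false

  Adj : Fin n → Fin n → Set
  Adj i j = T (adj i j)

IsClique : ∀ {n} → Graph n → Subset n → Set
IsClique G X = ∀ {i j} → i ∈ X → j ∈ X → i ≢ j → Graph.Adj G i j

IsIndependent : ∀ {n} → Graph n → Subset n → Set
IsIndependent G X = ∀ {i j} → i ∈ X → j ∈ X → ¬ Graph.Adj G i j

-- A split graph together with a chosen s-partition (K , S).
record SplitGraph (n : ℕ) : Set where
  field
    graph         : Graph n
    K S           : Subset n
    disjoint      : K ∩ S ≡ ⊥
    cover         : K ∪ S ≡ ⊤
    K-nonempty    : Nonempty K
    S-nonempty    : Nonempty S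
    K-clique      : IsClique graph K
    S-independent : IsIndependent graph S

-- Fin (m + n), viewed through splitAt, is the disjoint union of the two
-- vertex sets: the first m vertices are those of Sp, the last n those of G.
infixr 9 _∘_

_∘_ : ∀ {m n} → SplitGraph m → Graph n → Graph (m + n)
_∘_ {m} {n} Sp G = record
  { adj     = λ i j → edge (splitAt m i) (splitAt m j)
  ; adj-sym = λ i j → edge-sym (splitAt m i) (splitAt m j)
  ; no-loop = λ i → edge-irrefl (splitAt m i)
  }
  where
  open SplitGraph Sp using (graph; K)

  edge : Fin m ⊎ Fin n → Fin m ⊎ Fin n → Bool
  edge (inj₁ x) (inj₁ y) = Graph.adj graph x y
  edge (inj₁ x) (inj₂ _) = does (x ∈? K)
  edge (inj₂ _) (inj₁ y) = does (y ∈? K)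
  edge (inj₂ x) (inj₂ y) = Graph.adj G x y

  edge-sym : ∀ u v → edge u v ≡ edge v u
  edge-sym (inj₁ x) (inj₁ y) = Graph.adj-sym graph x y
  edge-sym (inj₁ _) (inj₂ _) = refl
  edge-sym (inj₂ _) (inj₁ _) = refl
  edge-sym (inj₂ x) (inj₂ y) = Graph.adj-sym G x y

  edge-irrefl : ∀ u → edge u u ≡ false
  edge-irrefl (inj₁ x) = Graph.no-loop graph x
  edge-irrefl (inj₂ x) = Graph.no-loop G x

Matrix : ℕ → Set
Matrix n = Fin n → Fin n → ℚ

identity : ∀ {n} → Matrix n
identity i j = if does (i ≟ j) then 1ℚ else 0ℚ

infixl 7 _·_

_·_ : ∀ {n} → Matrix n → Matrix n → Matrix n
(A · B) i j = sum λ k → A i k * B k j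

-- Matrices are functions, so they are compared entrywise.
infix 4 _≈_

_≈_ : ∀ {n} → Matrix n → Matrix n → Set
A ≈ B = ∀ i j → A i j ≡ B i j

-- Invertibility is over ℚ.  For a matrix with rational entries this agrees
-- with invertibility over ℝ, since the determinant does not change.
Invertible : ∀ {n} → Matrix n → Set
Invertible {n} A = ∃[ B ] (A · B ≈ identity × B · A ≈ identity)

adjacencyMatrix : ∀ {n} → Graph n → Matrix n
adjacencyMatrix G i j = if Graph.adj G i j then 1ℚ else 0ℚ

Nonsingular : ∀ {n} → Graph n → Set
Nonsingular G = Invertible (adjacencyMatrix G)

{-# OPTIONS --safe #-}
-- Let A and A′ be the adjacency matrices of Sp and Sp′, and u the indicator
-- vector of K.  The columns of A indexed by S are supported on K, so if they
-- are independent then |K| = |S| forces them to span ℚ^K, and A y = u for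
-- some y supported on S; moreover u ∙ y = 0.  The columns are independent as
-- soon as A or the matrix of the composition is nonsingular.  Given y, the
-- system A x + (1 ∙ x′) u = p, (u ∙ x) 1 + A′ x′ = q of the composition
-- decouples: u ∙ x = y ∙ A x = y ∙ p, so x′ solves A′ x′ = q − (y ∙ p) 1, and
-- then x = A⁻¹ p − (1 ∙ x′) y.
module Submission where

open import Defs
open import Algebra.Bundles using (CommutativeRing)
open import Data.Bool.Base using (true; false; if_then_else_)
open import Data.Fin.Base using (Fin; zero; suc; _↑ˡ_; _↑ʳ_; splitAt)
import Data.Fin.Properties as Fin
open import Data.Fin.Subset using (Subset; inside; outside; ∣_∣; _∈_; _∉_; _⊆_)
open import Data.Fin.Subset.Properties
  using (_∈?_; x∈p∩q⁺; x∈p∪q⁻; ∈⊤; ∉⊥; nonempty?; Empty-unique; ∣⊥∣≡0)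
open import Data.Nat.Base as ℕ using (ℕ; s≤s; s≤s⁻¹)
import Data.Nat.Properties as ℕ
open import Data.Product.Base using (_×_; _,_; proj₁; proj₂; ∃-syntax)
open import Data.Rational.Base using (ℚ; 0ℚ; 1ℚ; _+_; _*_; -_; 1/_; ≢-nonZero)
open import Data.Rational.Properties
  using (+-*-commutativeRing; _≟_; +-assoc; +-identityˡ; +-identityʳ;
         *-assoc; *-comm; *-identityˡ; *-inverseˡ; *-zeroˡ; *-zeroʳ)
open import Data.Rational.Solver using (module +-*-Solver)
open import Data.Sum.Base using (inj₁; inj₂; [_,_])
open import Data.Vec.Base using (_∷_; here; there; _[_]≔_)
open import Data.Vec.Functional as Vector using (Vector; _++_)
open import Function.Base using (_$_)
open import Function.Bundles using (_⇔_; mk⇔)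
open import Relation.Binary.PropositionalEquality
  using (_≡_; _≢_; _≗_; refl; sym; trans; cong; cong₂; subst; ≢-sym; module ≡-Reasoning)
open import Relation.Nullary using (¬_; yes; no; does; contradiction)
open import Relation.Nullary.Decidable using (_×-dec_; ¬?; dec-true; dec-false; decidable-stable)

open import Algebra.Properties.Semiring.Sum
  (CommutativeRing.semiring +-*-commutativeRing)
  using (sum; sum-cong-≗; sum-replicate-zero; *-distribˡ-sum; *-distribʳ-sum; ∑-distrib-+; ∑-comm)

open SplitGraph using (graph; K; S)
open +-*-Solver using (solve; _:+_; _:*_; :-_; _:=_; con)
open ≡-Reasoning

private variable
  m n : ℕ

-- Dot products and matrix-vector products over ℚ.

infix 8 _∙_

_∙_ : Vector ℚ n → Vector ℚ n → ℚ
x ∙ y = sum λ k → x k * y k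

infixr 7 _⋆_

_⋆_ : (Fin m → Vector ℚ n) → Vector ℚ n → Vector ℚ m
(A ⋆ x) i = A i ∙ x

∙-congˡ : ∀ (x : Vector ℚ n) {y z} → y ≗ z → x ∙ y ≡ x ∙ z
∙-congˡ x y≗z = sum-cong-≗ λ k → cong (x k *_) (y≗z k)

∙-comm : ∀ (x y : Vector ℚ n) → x ∙ y ≡ y ∙ x
∙-comm x y = sum-cong-≗ λ k → *-comm (x k) (y k)

∙-zero : ∀ (x y : Vector ℚ n) → (∀ k → x k * y k ≡ 0ℚ) → x ∙ y ≡ 0ℚ
∙-zero {n} x y xy≡0 = trans (sum-cong-≗ xy≡0) (sum-replicate-zero n)

∙-zeroʳ : ∀ (x : Vector ℚ n) {y} → y ≗ (λ _ → 0ℚ) → x ∙ y ≡ 0ℚ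
∙-zeroʳ x {y} y≗0 = ∙-zero x y λ k → trans (cong (x k *_) (y≗0 k)) (*-zeroʳ (x k))

∙-linearʳ : ∀ (x y z : Vector ℚ n) c → x ∙ (λ k → y k + c * z k) ≡ x ∙ y + c * x ∙ z
∙-linearʳ x y z c = begin
  x ∙ (λ k → y k + c * z k)
    ≡⟨ sum-cong-≗ (λ k → solve 4 (λ x y z c → x :* (y :+ c :* z) := x :* y :+ c :* (x :* z))
         refl (x k) (y k) (z k) c) ⟩
  sum (λ k → x k * y k + c * (x k * z k))
    ≡⟨ ∑-distrib-+ (λ k → x k * y k) (λ k → c * (x k * z k)) ⟩
  x ∙ y + sum (λ k → c * (x k * z k))
    ≡⟨ cong (x ∙ y +_) (sym (*-distribˡ-sum c (λ k → x k * z k))) ⟩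
  x ∙ y + c * x ∙ z ∎

∙-linearˡ : ∀ (x y z : Vector ℚ n) c → (λ k → x k + c * y k) ∙ z ≡ x ∙ z + c * y ∙ z
∙-linearˡ x y z c = begin
  (λ k → x k + c * y k) ∙ z  ≡⟨ ∙-comm (λ k → x k + c * y k) z ⟩
  z ∙ (λ k → x k + c * y k)  ≡⟨ ∙-linearʳ z x y c ⟩
  z ∙ x + c * z ∙ y          ≡⟨ cong₂ (λ a b → a + c * b) (∙-comm z x) (∙-comm z y) ⟩
  x ∙ z + c * y ∙ z          ∎

-- Interchange of a finite double sum. It yields both the compatibility of `_·_` with `_⋆_` and the
-- self-adjointness of symmetric matrices.
⋆-transpose : ∀ (A : Fin m → Fin n → ℚ) x y → x ∙ (A ⋆ y) ≡ (λ j → sum λ i → x i * A i j) ∙ y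
⋆-transpose A x y = begin
  x ∙ (A ⋆ y)
    ≡⟨ sum-cong-≗ (λ i → *-distribˡ-sum (x i) (λ j → A i j * y j)) ⟩
  (sum λ i → sum λ j → x i * (A i j * y j))
    ≡⟨ ∑-comm (λ i j → x i * (A i j * y j)) ⟩
  (sum λ j → sum λ i → x i * (A i j * y j))
    ≡⟨ sum-cong-≗ (λ j → trans (sum-cong-≗ λ i → sym (*-assoc (x i) (A i j) (y j)))
                               (sym (*-distribʳ-sum (y j) (λ i → x i * A i j)))) ⟩
  (λ j → sum λ i → x i * A i j) ∙ y ∎

·-⋆ : ∀ (A B : Matrix n) x → (A · B) ⋆ x ≗ A ⋆ B ⋆ x
·-⋆ A B x i = sym (⋆-transpose B (A i) x)

-- Vectors indexed by a disjoint union.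

sum-++ : ∀ m {n} (f : Vector ℚ (m ℕ.+ n)) →
         sum f ≡ sum (λ i → f (i ↑ˡ n)) + sum (λ j → f (m ↑ʳ j))
sum-++ ℕ.zero    f = sym (+-identityˡ (sum f))
sum-++ (ℕ.suc m) f = trans (cong (f zero +_) (sum-++ m (λ i → f (suc i)))) (sym (+-assoc (f zero) _ _))

++-↑ˡ : ∀ (x : Vector ℚ m) (y : Vector ℚ n) i → (x ++ y) (i ↑ˡ n) ≡ x i
++-↑ˡ {m} {n} x y i = cong [ x , y ] (Fin.splitAt-↑ˡ m i n)

++-↑ʳ : ∀ (x : Vector ℚ m) (y : Vector ℚ n) j → (x ++ y) (m ↑ʳ j) ≡ y j
++-↑ʳ {m} {n} x y j = cong [ x , y ] (Fin.splitAt-↑ʳ m n j)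

≗-split : ∀ (x y : Vector ℚ (m ℕ.+ n)) → (∀ i → x (i ↑ˡ n) ≡ y (i ↑ˡ n)) →
          (∀ j → x (m ↑ʳ j) ≡ y (m ↑ʳ j)) → x ≗ y
≗-split {m} {n} x y left right k with splitAt m k | Fin.join-splitAt m n k
... | inj₁ i | refl = left i
... | inj₂ j | refl = right j

-- The identity matrix and unit vectors.

identity-diag : ∀ (i : Fin n) → identity i i ≡ 1ℚ
identity-diag i = cong (if_then 1ℚ else 0ℚ) (dec-true (i Fin.≟ i) refl)

identity-off : ∀ (i j : Fin n) → i ≢ j → identity i j ≡ 0ℚ
identity-off i j i≢j = cong (if_then 1ℚ else 0ℚ) (dec-false (i Fin.≟ j) i≢j)

identity-sym : ∀ (i j : Fin n) → identity i j ≡ identity j i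
identity-sym i j with i Fin.≟ j
... | yes refl = sym (identity-diag i)
... | no  i≢j  = sym (identity-off j i (≢-sym i≢j))

identity-⋆ : ∀ (x : Vector ℚ n) → identity ⋆ x ≗ x
identity-⋆ x zero = begin
  1ℚ * x zero + _ ≡⟨ cong₂ _+_ (*-identityˡ (x zero)) (∙-zero (λ _ → 0ℚ) (λ k → x (suc k)) λ k → *-zeroˡ (x (suc k))) ⟩
  x zero + 0ℚ     ≡⟨ +-identityʳ (x zero) ⟩
  x zero          ∎
identity-⋆ x (suc i) = begin
  0ℚ * x zero + _  ≡⟨ cong₂ _+_ (*-zeroˡ (x zero)) (identity-⋆ (λ k → x (suc k)) i) ⟩
  0ℚ + x (suc i)   ≡⟨ +-identityˡ (x (suc i)) ⟩
  x (suc i)        ∎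

∙-identity : ∀ (x : Vector ℚ n) i → x ∙ identity i ≡ x i
∙-identity x i = trans (∙-comm x (identity i)) (identity-⋆ x i)

-- Invertibility of symmetric matrices as solvability of linear systems.

Symmetric : Matrix n → Set
Symmetric A = ∀ i j → A i j ≡ A j i

-- Surjectivity of `A ⋆_`: the form in which nonsingularity passes between a composition and its
-- factors, so that no inverse has to be written in blocks.
Solvable : Matrix n → Set
Solvable A = ∀ p → ∃[ x ] A ⋆ x ≗ p

⋆-selfAdjoint : {A : Matrix n} → Symmetric A → ∀ x y → (A ⋆ x) ∙ y ≡ x ∙ (A ⋆ y)
⋆-selfAdjoint {A = A} A-sym x y = sym $ trans (⋆-transpose A x y) $
  sum-cong-≗ λ j → cong (_* y j) $ sum-cong-≗ λ i →
  trans (*-comm (x i) (A i j)) (cong (_* x i) (A-sym i j))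

invertible⇒solvable : {A : Matrix n} → Invertible A → Solvable A
invertible⇒solvable {A = A} (B , AB≈1 , _) p = B ⋆ p , λ i → begin
  (A ⋆ B ⋆ p) i     ≡⟨ ·-⋆ A B p i ⟨
  ((A · B) ⋆ p) i   ≡⟨ sum-cong-≗ (λ k → cong (_* p k) (AB≈1 i k)) ⟩
  (identity ⋆ p) i  ≡⟨ identity-⋆ p i ⟩
  p i               ∎

invertible⇒injective : {A : Matrix n} → Invertible A →
                       ∀ x → A ⋆ x ≗ (λ _ → 0ℚ) → x ≗ (λ _ → 0ℚ)
invertible⇒injective {A = A} (B , _ , BA≈1) x Ax≗0 i = begin
  x i               ≡⟨ identity-⋆ x i ⟨
  (identity ⋆ x) i  ≡⟨ sum-cong-≗ (λ k → cong (_* x k) (BA≈1 i k)) ⟨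
  ((B · A) ⋆ x) i   ≡⟨ ·-⋆ B A x i ⟩
  (B ⋆ A ⋆ x) i     ≡⟨ ∙-zeroʳ (B i) Ax≗0 ⟩
  0ℚ                ∎

-- Solutions for the unit vectors are the columns of a right inverse `B`. Self-adjointness of `A`
-- makes `B` symmetric, and transposing `A · B ≈ identity` then shows that `B` is a left inverse
-- too.
solvable⇒invertible : {A : Matrix n} → Symmetric A → Solvable A → Invertible A
solvable⇒invertible {n} {A} A-sym solve-A = B , AB≈1 , BA≈1
  where
  column : Fin n → Vector ℚ n
  column j = proj₁ (solve-A (identity j))

  B : Matrix n
  B i j = column j i

  A⋆column : ∀ j → A ⋆ column j ≗ identity j
  A⋆column j = proj₂ (solve-A (identity j))

  B-sym : Symmetric B
  B-sym i j = begin
    column j i                     ≡⟨ identity-⋆ (column j) i ⟨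
    identity i ∙ column j          ≡⟨ sum-cong-≗ (λ k → cong (_* column j k) (A⋆column i k)) ⟨
    (A ⋆ column i) ∙ column j      ≡⟨ ⋆-selfAdjoint A-sym (column i) (column j) ⟩
    column i ∙ (A ⋆ column j)      ≡⟨ ∙-congˡ (column i) (A⋆column j) ⟩
    column i ∙ identity j          ≡⟨ ∙-identity (column i) j ⟩
    column i j                     ∎

  AB≈1 : A · B ≈ identity
  AB≈1 i j = trans (A⋆column j i) (identity-sym j i)

  BA≈1 : B · A ≈ identity
  BA≈1 i j = begin
    (B · A) i j  ≡⟨ sum-cong-≗ (λ k → trans (*-comm (B i k) (A k j)) (cong₂ _*_ (A-sym k j) (B-sym i k))) ⟩
    (A · B) j i  ≡⟨ AB≈1 j i ⟩
    identity j i ≡⟨ identity-sym j i ⟩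
    identity i j ∎

-- Homogeneous systems with more unknowns than equations.

infixl 5 _∖_

_∖_ : Subset n → Fin n → Subset n
p ∖ x = p [ x ]≔ outside

-- A pivot step removes one equation and at most one unknown, so unknowns still outnumber equations.
∣p∣≤1+∣p∖x∣ : ∀ (p : Subset n) x → ∣ p ∣ ℕ.≤ ℕ.suc ∣ p ∖ x ∣
∣p∣≤1+∣p∖x∣ (inside  ∷ p) zero    = ℕ.≤-refl
∣p∣≤1+∣p∖x∣ (outside ∷ p) zero    = ℕ.n≤1+n ∣ p ∣
∣p∣≤1+∣p∖x∣ (inside  ∷ p) (suc x) = s≤s (∣p∣≤1+∣p∖x∣ p x)
∣p∣≤1+∣p∖x∣ (outside ∷ p) (suc x) = ∣p∣≤1+∣p∖x∣ p x

x∉p∖x : ∀ (p : Subset n) x → x ∉ p ∖ x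
x∉p∖x (_ ∷ p) (suc x) (there x∈p∖x) = x∉p∖x p x x∈p∖x

p∖x⊆p : ∀ (p : Subset n) x → p ∖ x ⊆ p
p∖x⊆p (_ ∷ p) zero    (there y∈p)   = there y∈p
p∖x⊆p (_ ∷ p) (suc x) here          = here
p∖x⊆p (_ ∷ p) (suc x) (there y∈p∖x) = there (p∖x⊆p p x y∈p∖x)

-- Vectors on `S` are kept as vectors on all vertices, so columns can be selected without reindexing
-- the matrix.
SupportedOn : Subset n → Vector ℚ n → Set
SupportedOn S x = ∀ j → j ∉ S → x j ≡ 0ℚ

-- Gaussian elimination, one row at a time.
underdetermined : ∀ (P : Subset m) (S : Subset n) (R : Fin m → Vector ℚ n) → ∣ P ∣ ℕ.< ∣ S ∣ →
  ∃[ x ] SupportedOn S x × (∃[ j ] x j ≢ 0ℚ) × (∀ i → i ∈ P → R i ∙ x ≡ 0ℚ)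
underdetermined {ℕ.zero} {n} P S R ∣P∣<∣S∣ with nonempty? S
... | no  S-empty   = contradiction ∣P∣<∣S∣ (subst (λ k → ¬ ∣ P ∣ ℕ.< k)
  (sym (trans (cong ∣_∣ (Empty-unique S-empty)) (∣⊥∣≡0 n))) (ℕ.n≮0 {∣ P ∣}))
-- With no equations left, the unit vector at any element of `S` is a solution.
... | yes (s , s∈S) = identity s
  , (λ j j∉S → identity-off s j λ { refl → j∉S s∈S })
  , (s , λ eq → contradiction (trans (sym (identity-diag s)) eq) λ ())
  , λ ()
underdetermined {ℕ.suc _} (outside ∷ P) S R ∣P∣<∣S∣ =
  let x , x-supp , x≢0 , Rx≡0 = underdetermined P S (λ i → R (suc i)) ∣P∣<∣S∣
  in  x , x-supp , x≢0 , λ { (suc i) (there i∈P) → Rx≡0 i i∈P }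
underdetermined {ℕ.suc _} {n} (inside ∷ P) S R ∣P∣<∣S∣
  with Fin.any? (λ j → (j ∈? S) ×-dec ¬? (R zero j ≟ 0ℚ))
... | no  r≡0 =
  let x , x-supp , x≢0 , Rx≡0 = underdetermined P S (λ i → R (suc i)) (ℕ.<-trans (ℕ.n<1+n _) ∣P∣<∣S∣)
  in  x , x-supp , x≢0 , λ { zero _ → ∙-zero (R zero) x (r*x≡0 x x-supp) ; (suc i) (there i∈P) → Rx≡0 i i∈P }
  where
  r*x≡0 : ∀ x → SupportedOn S x → ∀ j → R zero j * x j ≡ 0ℚ
  r*x≡0 x x-supp j with j ∈? S
  ... | no  j∉S = trans (cong (R zero j *_) (x-supp j j∉S)) (*-zeroʳ (R zero j))
  ... | yes j∈S = trans
    (cong (_* x j) (decidable-stable (R zero j ≟ 0ℚ) λ r≢0 → r≡0 (j , j∈S , r≢0)))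
    (*-zeroˡ (x j))
... | yes (s , s∈S , rs≢0) = x , x-supp , (j₀ , xj₀≢0) , Rx≡0
  where
  instance _ = ≢-nonZero rs≢0

  r : Vector ℚ n
  r = R zero

  q : ℚ
  q = 1/ r s

  -- Each later row minus the multiple of the pivot row that clears its entry in column `s`.
  R′ : Fin _ → Vector ℚ n
  R′ i j = R (suc i) j + - (R (suc i) s * q) * r j

  reduced : ∃[ x ] SupportedOn (S ∖ s) x × (∃[ j ] x j ≢ 0ℚ) × (∀ i → i ∈ P → R′ i ∙ x ≡ 0ℚ)
  reduced = underdetermined P (S ∖ s) R′
    (s≤s⁻¹ (ℕ.≤-trans ∣P∣<∣S∣ (∣p∣≤1+∣p∖x∣ S s)))

  x′ : Vector ℚ n
  x′ = proj₁ reduced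

  x′-supp : SupportedOn (S ∖ s) x′
  x′-supp = proj₁ (proj₂ reduced)

  j₀ : Fin n
  j₀ = proj₁ (proj₁ (proj₂ (proj₂ reduced)))

  x′j₀≢0 : x′ j₀ ≢ 0ℚ
  x′j₀≢0 = proj₂ (proj₁ (proj₂ (proj₂ reduced)))

  -- Back-substitution: `x′` is zero at `s`, and `t` is the value there that makes the pivot row
  -- vanish.
  t : ℚ
  t = - (r ∙ x′ * q)

  x : Vector ℚ n
  x j = x′ j + t * identity s j

  x≡x′ : ∀ j → s ≢ j → x j ≡ x′ j
  x≡x′ j s≢j = begin
    x′ j + t * identity s j ≡⟨ cong (λ a → x′ j + t * a) (identity-off s j s≢j) ⟩
    x′ j + t * 0ℚ           ≡⟨ solve 2 (λ a t → a :+ t :* con 0ℚ := a) refl (x′ j) t ⟩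
    x′ j                    ∎

  xj₀≢0 : x j₀ ≢ 0ℚ
  xj₀≢0 xj₀≡0 = x′j₀≢0 (trans (sym (x≡x′ j₀ s≢j₀)) xj₀≡0)
    where
    -- The nonzero entry of `x′` lies away from `s`, so changing coordinate `s` leaves it intact.
    s≢j₀ : s ≢ j₀
    s≢j₀ s≡j₀ = x′j₀≢0 (subst (λ j → x′ j ≡ 0ℚ) s≡j₀ (x′-supp s (x∉p∖x S s)))

  x-supp : SupportedOn S x
  x-supp j j∉S = trans (x≡x′ j λ { refl → j∉S s∈S }) (x′-supp j λ j∈S∖s → j∉S (p∖x⊆p S s j∈S∖s))

  row∙x : ∀ a → a ∙ x ≡ a ∙ x′ + t * a s
  row∙x a = trans (∙-linearʳ a x′ (identity s) t) (cong (λ b → a ∙ x′ + t * b) (∙-identity a s))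

  Rx≡0 : ∀ i → i ∈ inside ∷ P → R i ∙ x ≡ 0ℚ
  Rx≡0 zero _ = begin
    r ∙ x                          ≡⟨ row∙x r ⟩
    r ∙ x′ + - (r ∙ x′ * q) * r s  ≡⟨ solve 3 (λ a q b → a :+ :- (a :* q) :* b := a :+ :- (a :* (q :* b)))
                                        refl (r ∙ x′) q (r s) ⟩
    r ∙ x′ + - (r ∙ x′ * (q * r s)) ≡⟨ cong (λ c → r ∙ x′ + - (r ∙ x′ * c)) (*-inverseˡ (r s)) ⟩
    r ∙ x′ + - (r ∙ x′ * 1ℚ)       ≡⟨ solve 1 (λ a → a :+ :- (a :* con 1ℚ) := con 0ℚ) refl (r ∙ x′) ⟩
    0ℚ                             ∎
  Rx≡0 (suc i) (there i∈P) = begin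
    a ∙ x                               ≡⟨ row∙x a ⟩
    -- Regrouped, the correction at `s` is exactly the pivot multiple that was subtracted from this
    -- row, so the reduced row applied to `x′` appears.
    a ∙ x′ + - (r ∙ x′ * q) * a s       ≡⟨ solve 4 (λ b d q c → b :+ :- (d :* q) :* c := b :+ :- (c :* q) :* d)
                                             refl (a ∙ x′) (r ∙ x′) q (a s) ⟩
    a ∙ x′ + - (a s * q) * r ∙ x′       ≡⟨ ∙-linearˡ a r x′ (- (a s * q)) ⟨
    (λ j → a j + - (a s * q) * r j) ∙ x′ ≡⟨ proj₂ (proj₂ (proj₂ reduced)) i i∈P ⟩
    0ℚ                                  ∎
    where
    a : Vector ℚ n
    a = R (suc i)

-- Adjacency matrices of split graphs and a preimage of the indicator of the clique.

adjacency-sym : ∀ (G : Graph n) → Symmetric (adjacencyMatrix G)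
adjacency-sym G i j = cong (if_then 1ℚ else 0ℚ) (Graph.adj-sym G i j)

-- The test `does (i ∈? P)` is the one that defines the edges of a composition, so the off-diagonal
-- blocks of its matrix reduce to this vector.
𝟙 : Subset n → Vector ℚ n
𝟙 P i = if does (i ∈? P) then 1ℚ else 0ℚ

𝟙-∉ : ∀ {P : Subset n} {i} → i ∉ P → 𝟙 P i ≡ 0ℚ
𝟙-∉ {P = P} {i} i∉P = cong (if_then 1ℚ else 0ℚ) (dec-false (i ∈? P) i∉P)

module _ (Sp : SplitGraph n) where

  private
    A : Matrix n
    A = adjacencyMatrix (graph Sp)

    u : Vector ℚ n
    u = 𝟙 (K Sp)

  ∈K⇒∉S : ∀ {i} → i ∈ K Sp → i ∉ S Sp
  ∈K⇒∉S i∈K i∈S = ∉⊥ (subst (_ ∈_) (SplitGraph.disjoint Sp) (x∈p∩q⁺ (i∈K , i∈S)))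

  ∉K⇒∈S : ∀ {i} → i ∉ K Sp → i ∈ S Sp
  ∉K⇒∈S {i} i∉K with x∈p∪q⁻ (K Sp) (S Sp) (subst (i ∈_) (sym (SplitGraph.cover Sp)) ∈⊤)
  ... | inj₁ i∈K = contradiction i∈K i∉K
  ... | inj₂ i∈S = i∈S

  𝟙K-orthogonal : ∀ y → SupportedOn (S Sp) y → u ∙ y ≡ 0ℚ
  𝟙K-orthogonal y y-supp = ∙-zero u y u*y≡0
    where
    u*y≡0 : ∀ k → u k * y k ≡ 0ℚ
    u*y≡0 k with k ∈? K Sp
    ... | yes k∈K = trans (cong (1ℚ *_) (y-supp k (∈K⇒∉S k∈K))) (*-zeroʳ 1ℚ)
    ... | no  _   = *-zeroˡ (y k)

  -- There are no edges inside `S`, so the image of a vector supported on `S` lives on `K`: only the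
  -- rows in `K` impose equations.
  independent-rows : ∀ y → SupportedOn (S Sp) y → ∀ {i} → i ∈ S Sp → (A ⋆ y) i ≡ 0ℚ
  independent-rows y y-supp {i} i∈S = ∙-zero (A i) y A*y≡0
    where
    A*y≡0 : ∀ k → A i k * y k ≡ 0ℚ
    A*y≡0 k with k ∈? S Sp
    ... | no  k∉S = trans (cong (A i k *_) (y-supp k k∉S)) (*-zeroʳ (A i k))
    ... | yes k∈S with Graph.adj (graph Sp) i k | SplitGraph.S-independent Sp i∈S k∈S
    ...   | false | _     = *-zeroˡ (y k)
    ...   | true  | ¬adj  = contradiction _ ¬adj

  -- In the rows of `K`, the vector `u` and the columns of `S` are one more vector than there are
  -- rows, hence dependent. Injectivity on `S` forces `u` to occur in the dependence, so it is a
  -- combination of those columns.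
  balanced⇒𝟙K-preimage : ∣ K Sp ∣ ≡ ∣ S Sp ∣ →
    (∀ y → SupportedOn (S Sp) y → A ⋆ y ≗ (λ _ → 0ℚ) → y ≗ (λ _ → 0ℚ)) →
    ∃[ y ] A ⋆ y ≗ u × u ∙ y ≡ 0ℚ
  balanced⇒𝟙K-preimage ∣K∣≡∣S∣ injective-on-S =
    y , A⋆y≗u , 𝟙K-orthogonal y λ j j∉S → trans (cong (t *_) (z-supp j j∉S)) (*-zeroʳ t)
    where
    -- A dependence between u (coordinate zero) and the columns of S.
    dependence : ∃[ w ] SupportedOn (inside ∷ S Sp) w × (∃[ j ] w j ≢ 0ℚ) ×
      (∀ i → i ∈ K Sp → (u i Vector.∷ A i) ∙ w ≡ 0ℚ)
    dependence = underdetermined (K Sp) (inside ∷ S Sp) (λ i → u i Vector.∷ A i) (s≤s (ℕ.≤-reflexive ∣K∣≡∣S∣))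

    w : Vector ℚ (ℕ.suc n)
    w = proj₁ dependence

    c : ℚ
    c = w zero

    z : Vector ℚ n
    z j = w (suc j)

    z-supp : SupportedOn (S Sp) z
    z-supp j j∉S = proj₁ (proj₂ dependence) (suc j) λ { (there j∈S) → j∉S j∈S }

    relation : ∀ i → u i * c + (A ⋆ z) i ≡ 0ℚ
    relation i with i ∈? K Sp | proj₂ (proj₂ (proj₂ dependence)) i
    ... | yes i∈K | rel = rel i∈K
    -- Outside `K` the relation is automatic: `u` vanishes there, and so do the columns of `S`.
    ... | no  i∉K | _   = trans
      (cong₂ _+_ (*-zeroˡ c) (independent-rows z z-supp (∉K⇒∈S i∉K)))
      (+-identityˡ 0ℚ)

    -- If `c` were zero, `z` would be a dependence among the columns of `S` alone, hence zero, and
    -- `w` would have no nonzero entry.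
    c≢0 : c ≢ 0ℚ
    c≢0 c≡0 = proj₂ (proj₁ (proj₂ (proj₂ dependence))) (w≗0 _)
      where
      A⋆z≗0 : A ⋆ z ≗ (λ _ → 0ℚ)
      A⋆z≗0 i = begin
        (A ⋆ z) i             ≡⟨ solve 2 (λ a b → b := a :* con 0ℚ :+ b) refl (u i) ((A ⋆ z) i) ⟩
        u i * 0ℚ + (A ⋆ z) i  ≡⟨ cong (λ a → u i * a + (A ⋆ z) i) (sym c≡0) ⟩
        u i * c + (A ⋆ z) i   ≡⟨ relation i ⟩
        0ℚ                    ∎

      w≗0 : w ≗ (λ _ → 0ℚ)
      w≗0 zero    = c≡0
      w≗0 (suc j) = injective-on-S z z-supp A⋆z≗0 j

    instance _ = ≢-nonZero c≢0

    -- Solves `u c + A z = 0` for `u`.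
    t : ℚ
    t = - 1/ c

    y : Vector ℚ n
    y j = t * z j

    A⋆y≗u : A ⋆ y ≗ u
    A⋆y≗u i = begin
      (A ⋆ y) i
        ≡⟨ sum-cong-≗ (λ k → solve 3 (λ a t b → a :* (t :* b) := t :* (a :* b)) refl (A i k) t (z k)) ⟩
      sum (λ k → t * (A i k * z k))
        ≡⟨ *-distribˡ-sum t (λ k → A i k * z k) ⟨
      - 1/ c * (A ⋆ z) i
        ≡⟨ solve 4 (λ q b u c → :- q :* b := u :* (q :* c) :+ :- (q :* (u :* c :+ b)))
             refl (1/ c) ((A ⋆ z) i) (u i) c ⟩
      u i * (1/ c * c) + - (1/ c * (u i * c + (A ⋆ z) i))
        ≡⟨ cong₂ (λ a b → u i * a + - (1/ c * b)) (*-inverseˡ c) (relation i) ⟩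
      u i * 1ℚ + - (1/ c * 0ℚ)
        ≡⟨ solve 2 (λ u q → u :* con 1ℚ :+ :- (q :* con 0ℚ) := u) refl (u i) (1/ c) ⟩
      u i ∎

-- The block system of a composition and its decoupling.

module _ (Sp : SplitGraph m) (G : Graph n) where

  private
    A : Matrix m
    A = adjacencyMatrix (graph Sp)

    A′ : Matrix n
    A′ = adjacencyMatrix G

    M : Matrix (m ℕ.+ n)
    M = adjacencyMatrix (Sp ∘ G)

    u : Vector ℚ m
    u = 𝟙 (K Sp)

  -- `M` has diagonal blocks `A` and `A′`; its off-diagonal blocks are the rank-one matrix of rows
  -- `u i` repeated, and its transpose. So each half of `z` reaches the other only through a single
  -- number.
  ∘-⋆-↑ˡ : ∀ z i → (M ⋆ z) (i ↑ˡ n) ≡ (A ⋆ λ k → z (k ↑ˡ n)) i + u i * sum (λ k → z (m ↑ʳ k))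
  ∘-⋆-↑ˡ z i = trans (sum-++ m _) $ cong₂ _+_
    (sum-cong-≗ λ k → cong (_* z (k ↑ˡ n)) (left k))
    (trans (sum-cong-≗ λ k → cong (_* z (m ↑ʳ k)) (right k)) (sym (*-distribˡ-sum (u i) (λ k → z (m ↑ʳ k)))))
    where
    left : ∀ k → M (i ↑ˡ n) (k ↑ˡ n) ≡ A i k
    left k rewrite Fin.splitAt-↑ˡ m i n | Fin.splitAt-↑ˡ m k n = refl

    right : ∀ k → M (i ↑ˡ n) (m ↑ʳ k) ≡ u i
    right k rewrite Fin.splitAt-↑ˡ m i n | Fin.splitAt-↑ʳ m n k = refl

  ∘-⋆-↑ʳ : ∀ z j → (M ⋆ z) (m ↑ʳ j) ≡ u ∙ (λ k → z (k ↑ˡ n)) + (A′ ⋆ λ k → z (m ↑ʳ k)) j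
  ∘-⋆-↑ʳ z j = trans (sum-++ m _) $ cong₂ _+_
    (sum-cong-≗ λ k → cong (_* z (k ↑ˡ n)) (left k))
    (sum-cong-≗ λ k → cong (_* z (m ↑ʳ k)) (right k))
    where
    left : ∀ k → M (m ↑ʳ j) (k ↑ˡ n) ≡ u k
    left k rewrite Fin.splitAt-↑ʳ m n j | Fin.splitAt-↑ˡ m k n = refl

    right : ∀ k → M (m ↑ʳ j) (m ↑ʳ k) ≡ A′ j k
    right k rewrite Fin.splitAt-↑ʳ m n j | Fin.splitAt-↑ʳ m n k = refl



  ∘-⋆-++-↑ˡ : ∀ x x′ i → (M ⋆ (x ++ x′)) (i ↑ˡ n) ≡ (A ⋆ x) i + u i * sum x′
  ∘-⋆-++-↑ˡ x x′ i = trans (∘-⋆-↑ˡ (x ++ x′) i) $ cong₂ (λ a b → a + u i * b)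
    (∙-congˡ (A i) (++-↑ˡ x x′)) (sum-cong-≗ (++-↑ʳ x x′))

  ∘-⋆-++-↑ʳ : ∀ x x′ j → (M ⋆ (x ++ x′)) (m ↑ʳ j) ≡ u ∙ x + (A′ ⋆ x′) j
  ∘-⋆-++-↑ʳ x x′ j = trans (∘-⋆-↑ʳ (x ++ x′) j) $ cong₂ _+_
    (∙-congˡ u (++-↑ˡ x x′)) (∙-congˡ (A′ j) (++-↑ʳ x x′))

  private
    -- Extend `y` by zero: the rows of `Sp` give `A ⋆ y`, and the rows of `G` give `u ∙ y`, which
    -- vanishes because `K` and `S` are disjoint.
    ∘-injective⇒injective-on-S : (∀ z → M ⋆ z ≗ (λ _ → 0ℚ) → z ≗ (λ _ → 0ℚ)) →
      ∀ y → SupportedOn (S Sp) y → A ⋆ y ≗ (λ _ → 0ℚ) → y ≗ (λ _ → 0ℚ)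
    ∘-injective⇒injective-on-S M-injective y y-supp A⋆y≗0 i = begin
      y i          ≡⟨ ++-↑ˡ y (λ _ → 0ℚ) i ⟨
      z (i ↑ˡ n)   ≡⟨ M-injective z (≗-split _ _ M⋆z≗0ˡ M⋆z≗0ʳ) (i ↑ˡ n) ⟩
      0ℚ           ∎
      where
      z : Vector ℚ (m ℕ.+ n)
      z = y ++ (λ _ → 0ℚ)

      M⋆z≗0ˡ : ∀ i → (M ⋆ z) (i ↑ˡ n) ≡ 0ℚ
      M⋆z≗0ˡ i = begin
        (M ⋆ z) (i ↑ˡ n)          ≡⟨ ∘-⋆-++-↑ˡ y (λ _ → 0ℚ) i ⟩
        (A ⋆ y) i + u i * sum {n} (λ _ → 0ℚ) ≡⟨ cong₂ (λ a b → a + u i * b) (A⋆y≗0 i) (sum-replicate-zero n) ⟩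
        0ℚ + u i * 0ℚ ≡⟨ solve 1 (λ a → con 0ℚ :+ a :* con 0ℚ := con 0ℚ) refl (u i) ⟩
        0ℚ ∎

      M⋆z≗0ʳ : ∀ j → (M ⋆ z) (m ↑ʳ j) ≡ 0ℚ
      M⋆z≗0ʳ j = begin
        (M ⋆ z) (m ↑ʳ j)          ≡⟨ ∘-⋆-++-↑ʳ y (λ _ → 0ℚ) j ⟩
        u ∙ y + (A′ ⋆ λ _ → 0ℚ) j ≡⟨ cong₂ _+_ (𝟙K-orthogonal Sp y y-supp) (∙-zeroʳ (A′ j) λ _ → refl) ⟩
        0ℚ + 0ℚ                   ≡⟨ +-identityˡ 0ℚ ⟩
        0ℚ                        ∎

    module Decouple (y : Vector ℚ m) (A⋆y≗u : A ⋆ y ≗ u) (u∙y≡0 : u ∙ y ≡ 0ℚ) where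

      -- The coupling number `u ∙ x` depends on `x` only through `A ⋆ x`, which the upper half of
      -- the system controls.
      u∙x : ∀ x → u ∙ x ≡ y ∙ (A ⋆ x)
      u∙x x = begin
        u ∙ x        ≡⟨ sum-cong-≗ (λ k → cong (_* x k) (A⋆y≗u k)) ⟨
        (A ⋆ y) ∙ x  ≡⟨ ⋆-selfAdjoint (adjacency-sym (graph Sp)) y x ⟩
        y ∙ (A ⋆ x)  ∎

      A-shift : ∀ x c i → (A ⋆ λ k → x k + c * y k) i ≡ (A ⋆ x) i + c * u i
      A-shift x c i = trans (∙-linearʳ (A i) x y c) (cong (λ a → (A ⋆ x) i + c * a) (A⋆y≗u i))

      -- Solve the composition for `p` extended by zero. The upper half has an extra term `c` times
      -- `u`, which adding `c` times `y` to `x` absorbs.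
      factorˡ : Solvable M → Solvable A
      factorˡ solve-M p = (λ k → x k + c * y k) , λ i → begin
        (A ⋆ λ k → x k + c * y k) i  ≡⟨ A-shift x c i ⟩
        (A ⋆ x) i + c * u i          ≡⟨ cong ((A ⋆ x) i +_) (*-comm c (u i)) ⟩
        (A ⋆ x) i + u i * c          ≡⟨ ∘-⋆-↑ˡ z i ⟨
        (M ⋆ z) (i ↑ˡ n)             ≡⟨ proj₂ (solve-M (p ++ λ _ → 0ℚ)) (i ↑ˡ n) ⟩
        (p ++ λ _ → 0ℚ) (i ↑ˡ n)     ≡⟨ ++-↑ˡ p (λ _ → 0ℚ) i ⟩
        p i                          ∎
        where
        z : Vector ℚ (m ℕ.+ n)
        z = proj₁ (solve-M (p ++ λ _ → 0ℚ))

        x : Vector ℚ m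
        x k = z (k ↑ˡ n)

        c : ℚ
        c = sum λ k → z (m ↑ʳ k)

      -- Solve the composition for `q` preceded by zeros. Pairing the upper half with `y` and using
      -- `u ∙ y ≡ 0ℚ` gives `u ∙ x ≡ 0ℚ`, so the lower half is the system of `A′` alone.
      factorʳ : Solvable M → Solvable A′
      factorʳ solve-M q = x′ , λ j → begin
        (A′ ⋆ x′) j          ≡⟨ +-identityˡ ((A′ ⋆ x′) j) ⟨
        0ℚ + (A′ ⋆ x′) j     ≡⟨ cong (_+ (A′ ⋆ x′) j) u∙x≡0 ⟨
        u ∙ x + (A′ ⋆ x′) j  ≡⟨ ∘-⋆-↑ʳ z j ⟨
        (M ⋆ z) (m ↑ʳ j)     ≡⟨ proj₂ (solve-M ((λ _ → 0ℚ) ++ q)) (m ↑ʳ j) ⟩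
        ((λ _ → 0ℚ) ++ q) (m ↑ʳ j) ≡⟨ ++-↑ʳ {m} (λ _ → 0ℚ) q j ⟩
        q j                  ∎
        where
        z : Vector ℚ (m ℕ.+ n)
        z = proj₁ (solve-M ((λ _ → 0ℚ) ++ q))

        x : Vector ℚ m
        x k = z (k ↑ˡ n)

        x′ : Vector ℚ n
        x′ k = z (m ↑ʳ k)

        A⋆x+cu≗0 : ∀ i → (A ⋆ x) i + sum x′ * u i ≡ 0ℚ
        A⋆x+cu≗0 i = begin
          (A ⋆ x) i + sum x′ * u i    ≡⟨ cong ((A ⋆ x) i +_) (*-comm (sum x′) (u i)) ⟩
          (A ⋆ x) i + u i * sum x′    ≡⟨ ∘-⋆-↑ˡ z i ⟨
          (M ⋆ z) (i ↑ˡ n)            ≡⟨ proj₂ (solve-M ((λ _ → 0ℚ) ++ q)) (i ↑ˡ n) ⟩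
          ((λ _ → 0ℚ) ++ q) (i ↑ˡ n)  ≡⟨ ++-↑ˡ (λ _ → 0ℚ) q i ⟩
          0ℚ                          ∎

        u∙x≡0 : u ∙ x ≡ 0ℚ
        u∙x≡0 = begin
          u ∙ x                                    ≡⟨ u∙x x ⟩
          y ∙ (A ⋆ x)                              ≡⟨ solve 2 (λ a c → a := a :+ c :* con 0ℚ) refl (y ∙ (A ⋆ x)) (sum x′) ⟩
          y ∙ (A ⋆ x) + sum x′ * 0ℚ                ≡⟨ cong (λ a → y ∙ (A ⋆ x) + sum x′ * a) (trans (∙-comm y u) u∙y≡0) ⟨
          y ∙ (A ⋆ x) + sum x′ * y ∙ u             ≡⟨ ∙-linearʳ y (A ⋆ x) u (sum x′) ⟨
          y ∙ (λ i → (A ⋆ x) i + sum x′ * u i)     ≡⟨ ∙-zeroʳ y A⋆x+cu≗0 ⟩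
          0ℚ                                       ∎

      compose : Solvable A → Solvable A′ → Solvable M
      compose solve-A solve-A′ r = x ++ x′ , ≗-split _ _ upper lower
        where
        p : Vector ℚ m
        p i = r (i ↑ˡ n)

        q : Vector ℚ n
        q j = r (m ↑ʳ j)

        a : Vector ℚ m
        a = proj₁ (solve-A p)

        -- The right-hand side anticipates the value `y ∙ p` that `u ∙ x` will take.
        x′ : Vector ℚ n
        x′ = proj₁ (solve-A′ λ j → q j + - (y ∙ p))

        -- The multiple of `y` cancels the term `u i * sum x′` in the upper half; as `u ∙ y` is
        -- zero, it leaves `u ∙ x` unchanged.
        x : Vector ℚ m
        x k = a k + - sum x′ * y k

        u∙x≡y∙p : u ∙ x ≡ y ∙ p
        u∙x≡y∙p = begin
          u ∙ x                         ≡⟨ ∙-linearʳ u a y (- sum x′) ⟩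
          u ∙ a + - sum x′ * u ∙ y      ≡⟨ cong₂ (λ b c → b + - sum x′ * c) (u∙x a) u∙y≡0 ⟩
          y ∙ (A ⋆ a) + - sum x′ * 0ℚ   ≡⟨ solve 2 (λ b s → b :+ :- s :* con 0ℚ := b) refl (y ∙ (A ⋆ a)) (sum x′) ⟩
          y ∙ (A ⋆ a)                   ≡⟨ ∙-congˡ y (proj₂ (solve-A p)) ⟩
          y ∙ p                         ∎

        upper : ∀ i → (M ⋆ (x ++ x′)) (i ↑ˡ n) ≡ p i
        upper i = begin
          (M ⋆ (x ++ x′)) (i ↑ˡ n)                      ≡⟨ ∘-⋆-++-↑ˡ x x′ i ⟩
          (A ⋆ x) i + u i * sum x′                      ≡⟨ cong (_+ u i * sum x′) (A-shift a (- sum x′) i) ⟩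
          (A ⋆ a) i + - sum x′ * u i + u i * sum x′     ≡⟨ solve 3 (λ b s u → b :+ :- s :* u :+ u :* s := b)
                                                             refl ((A ⋆ a) i) (sum x′) (u i) ⟩
          (A ⋆ a) i                                     ≡⟨ proj₂ (solve-A p) i ⟩
          p i                                           ∎

        lower : ∀ j → (M ⋆ (x ++ x′)) (m ↑ʳ j) ≡ q j
        lower j = begin
          (M ⋆ (x ++ x′)) (m ↑ʳ j)    ≡⟨ ∘-⋆-++-↑ʳ x x′ j ⟩
          u ∙ x + (A′ ⋆ x′) j         ≡⟨ cong₂ _+_ u∙x≡y∙p (proj₂ (solve-A′ _) j) ⟩
          y ∙ p + (q j + - (y ∙ p))   ≡⟨ solve 2 (λ b q → b :+ (q :+ :- b) := q) refl (y ∙ p) (q j) ⟩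
          q j                         ∎

  -- Both directions start from the preimage `y` of `u`; they differ in the source of injectivity on
  -- `S`, which is the composition in one and `Sp` itself in the other.
  balanced-∘-nonsingular : ∣ K Sp ∣ ≡ ∣ S Sp ∣ →
    Nonsingular (Sp ∘ G) ⇔ (Nonsingular (graph Sp) × Nonsingular G)
  balanced-∘-nonsingular ∣K∣≡∣S∣ = mk⇔ to from
    where
    to : Nonsingular (Sp ∘ G) → Nonsingular (graph Sp) × Nonsingular G
    to M-inv = solvable⇒invertible (adjacency-sym (graph Sp)) (factorˡ solve-M)
             , solvable⇒invertible (adjacency-sym G) (factorʳ solve-M)
      where
      solve-M : Solvable M
      solve-M = invertible⇒solvable M-inv

      preimage : ∃[ y ] A ⋆ y ≗ u × u ∙ y ≡ 0ℚ
      preimage = balanced⇒𝟙K-preimage Sp ∣K∣≡∣S∣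
        (∘-injective⇒injective-on-S (invertible⇒injective M-inv))

      open Decouple (proj₁ preimage) (proj₁ (proj₂ preimage)) (proj₂ (proj₂ preimage))

    from : Nonsingular (graph Sp) × Nonsingular G → Nonsingular (Sp ∘ G)
    from (A-inv , A′-inv) = solvable⇒invertible (adjacency-sym (Sp ∘ G))
      (compose (invertible⇒solvable A-inv) (invertible⇒solvable A′-inv))
      where
      preimage : ∃[ y ] A ⋆ y ≗ u × u ∙ y ≡ 0ℚ
      preimage = balanced⇒𝟙K-preimage Sp ∣K∣≡∣S∣ λ y _ → invertible⇒injective A-inv y

      open Decouple (proj₁ preimage) (proj₁ (proj₂ preimage)) (proj₂ (proj₂ preimage))

theorem7p2 : ∀ (m n : ℕ) (Sp : SplitGraph m) (Sp′ : SplitGraph n) →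
    ∣ K Sp ∣ ≡ ∣ S Sp ∣ →
    ∣ K Sp′ ∣ ≡ ∣ S Sp′ ∣ →
    Nonsingular (Sp ∘ graph Sp′) ⇔ (Nonsingular (graph Sp) × Nonsingular (graph Sp′))
theorem7p2 m n Sp Sp′ ∣K∣≡∣S∣ _ = balanced-∘-nonsingular Sp (graph Sp′) ∣K∣≡∣S∣
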